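{- For every odd integer $n\ge 1$, $\chi_{la}(FB(n)) = 3$.
   Context: All graphs are finite and simple. For a graph $G=(V,E)$ with $q=|E|$ edges, a bijection $f:E\to\{1,2,\dots,q\}$ is a local antimagic labeling of $G$ if $f^+(u)\ne f^+(v)$ for every edge $uv\in E$, where $f^+(u)=\sum_{e\in E(u)}f(e)$ and $E(u)$ is the set of edges incident to $u$. The color number $c(f)$ is the number of distinct values of $f^+$ on $V$. The local antimagic chromatic number $\chi_{la}(G)$ is the minimum of $c(f)$ over all local antimagic labelings $f$ of $G$. $P_3$ is the path on 3 vertices, $nP_3$ is the disjoint union of $n$ copies of $P_3$, $O_m$ is the null (edgeless) graph on $m$ vertices, and $G\vee H$ is the join of $G$ and $H$ (disjoint union together with all edges between $G$ and $H$). $FB(n)=nP_3\vee O_1$ is the fan graph with $n$ blades. -}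

module Defs where

open import Data.Fin using (Fin; zero; suc; toℕ; inject₁)
open import Data.Fin.Properties using (+↔⊎; *↔×; suc-injective; toℕ-inject₁) renaming (_≟_ to _≟F_)
open import Data.List using (List; length; map; filter; tabulate; deduplicate)
open import Data.Nat using (ℕ; zero; suc; _+_; _*_; _≤_; _≟_)
open import Data.Nat.ListAction using (sum)
open import Data.Nat.Properties using (1+n≢n; m≢1+n+m)
open import Data.Product using (_×_; _,_; proj₁; proj₂; ∃-syntax; swap)
open import Data.Product.Function.NonDependent.Propositional using (_×-↔_)
open import Data.Sum using (_⊎_; inj₁; inj₂)
open import Data.Sum.Function.Propositional using (_⊎-↔_)
open import Data.Sum.Properties using (inj₁-injective; inj₂-injective)
open import Data.Empty using (⊥-elim)
open import Function using (_∘_; _↔_; _⤖_; Inverse; Bijection)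
open import Function.Construct.Composition using (_↔-∘_)
open import Function.Construct.Identity using (↔-id)
open import Function.Construct.Symmetry using (↔-sym)
open import Function.Properties.Inverse using (↔⇒↣)
open import Relation.Binary.Definitions using (DecidableEquality)
open import Relation.Binary.PropositionalEquality using (_≡_; _≢_; refl; sym; trans; cong; cong₂)
open import Relation.Nullary.Decidable using (Dec; _⊎-dec_; via-injection)

-- An edge is stored with its two ends in an arbitrary order.  That order
-- carries no information: `simple` identifies edges with the same
-- unordered pair of ends, and `Incident` looks at both of them.
record Graph : Set₁ where
  field
    V E      : Set
    order    : ℕ
    size     : ℕ
    V↔Fin    : V ↔ Fin order
    E↔Fin    : E ↔ Fin size
    ends     : E → V × V
    loopless : ∀ e → proj₁ (ends e) ≢ proj₂ (ends e)
    simple   : ∀ d e → ends d ≡ ends e ⊎ ends d ≡ swap (ends e) → d ≡ e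

  vertices : List V
  vertices = tabulate (Inverse.from V↔Fin)

  edges : List E
  edges = tabulate (Inverse.from E↔Fin)

  _≟V_ : DecidableEquality V
  _≟V_ = via-injection (↔⇒↣ V↔Fin) _≟F_

  Incident : V → E → Set
  Incident u e = u ≡ proj₁ (ends e) ⊎ u ≡ proj₂ (ends e)

  incident? : ∀ u e → Dec (Incident u e)
  incident? u e = (u ≟V proj₁ (ends e)) ⊎-dec (u ≟V proj₂ (ends e))

module _ (G : Graph) where
  open Graph G

  Labeling : Set
  Labeling = E ⤖ Fin size

  -- The element i of Fin size stands for the label i + 1, so that the
  -- labels are 1, …, size.
  label : Labeling → E → ℕ
  label f e = suc (toℕ (Bijection.to f e))

  vertexSum : Labeling → V → ℕ
  vertexSum f u = sum (map (label f) (filter (incident? u) edges))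

  LocalAntimagic : Labeling → Set
  LocalAntimagic f =
    ∀ e → vertexSum f (proj₁ (ends e)) ≢ vertexSum f (proj₂ (ends e))

  colorNumber : Labeling → ℕ
  colorNumber f = length (deduplicate _≟_ (map (vertexSum f) vertices))

-- A relation rather than a function, since a graph need not have any local
-- antimagic labeling (for example a single edge).
χla[_]≡_ : Graph → ℕ → Set
χla[ G ]≡ k =
    (∃[ f ] LocalAntimagic G f × colorNumber G f ≡ k)
  × (∀ f → LocalAntimagic G f → k ≤ colorNumber G f)

O : ℕ → Graph
O m = record
  { V = Fin m ; E = Fin 0 ; order = m ; size = 0
  ; V↔Fin = ↔-id _ ; E↔Fin = ↔-id _
  ; ends = λ () ; loopless = λ () ; simple = λ () }

P : ℕ → Graph
P zero = O zero
P (suc k) = record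
  { V = Fin (suc k) ; E = Fin k ; order = suc k ; size = k
  ; V↔Fin = ↔-id _ ; E↔Fin = ↔-id _
  ; ends = λ i → inject₁ i , suc i
  ; loopless = λ i eq →
      1+n≢n (sym (trans (sym (toℕ-inject₁ i)) (cong toℕ eq)))
  ; simple = simple }
  where
  simple : ∀ (i j : Fin k) →
           (inject₁ i , suc i) ≡ (inject₁ j , suc j)
           ⊎ (inject₁ i , suc i) ≡ (suc j , inject₁ j) → i ≡ j
  simple i j (inj₁ eq) = suc-injective (cong proj₂ eq)
  simple i j (inj₂ eq) = ⊥-elim (m≢1+n+m (toℕ i) {1} (trans i≡1+j (cong suc (sym 1+i≡j))))
    where
    i≡1+j : toℕ i ≡ suc (toℕ j)
    i≡1+j = trans (sym (toℕ-inject₁ i)) (cong (toℕ ∘ proj₁) eq)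
    1+i≡j : suc (toℕ i) ≡ toℕ j
    1+i≡j = trans (cong (toℕ ∘ proj₂) eq) (toℕ-inject₁ j)

infixr 7 _·_
_·_ : ℕ → Graph → Graph
n · G = record
  { V = Fin n × V ; E = Fin n × E ; order = n * order ; size = n * size
  ; V↔Fin = ↔-sym *↔× ↔-∘ (↔-id _ ×-↔ V↔Fin)
  ; E↔Fin = ↔-sym *↔× ↔-∘ (↔-id _ ×-↔ E↔Fin)
  ; ends = λ (i , e) → (i , proj₁ (ends e)) , (i , proj₂ (ends e))
  ; loopless = λ (_ , e) eq → loopless e (cong proj₂ eq)
  ; simple = λ where
      (_ , d) (_ , e) (inj₁ eq) → cong₂ _,_ (cong (proj₁ ∘ proj₁) eq)
        (simple d e (inj₁ (cong (λ (u , v) → proj₂ u , proj₂ v) eq)))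
      (_ , d) (_ , e) (inj₂ eq) → cong₂ _,_ (cong (proj₁ ∘ proj₁) eq)
        (simple d e (inj₂ (cong (λ (u , v) → proj₂ u , proj₂ v) eq))) }
  where open Graph G

infixr 6 _∨_
_∨_ : Graph → Graph → Graph
G ∨ H = record
  { V = G.V ⊎ H.V ; E = E ; order = G.order + H.order
  ; size = G.size + (H.size + G.order * H.order)
  ; V↔Fin = ↔-sym +↔⊎ ↔-∘ (G.V↔Fin ⊎-↔ H.V↔Fin)
  ; E↔Fin = ↔-sym +↔⊎ ↔-∘ (G.E↔Fin ⊎-↔
              (↔-sym +↔⊎ ↔-∘ (H.E↔Fin ⊎-↔
                (↔-sym *↔× ↔-∘ (G.V↔Fin ×-↔ H.V↔Fin)))))
  ; ends = ends ; loopless = loopless ; simple = simple }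
  where
  module G = Graph G
  module H = Graph H

  E : Set
  E = G.E ⊎ (H.E ⊎ (G.V × H.V))

  ends : E → (G.V ⊎ H.V) × (G.V ⊎ H.V)
  ends (inj₁ e)              = inj₁ (proj₁ (G.ends e)) , inj₁ (proj₂ (G.ends e))
  ends (inj₂ (inj₁ e))       = inj₂ (proj₁ (H.ends e)) , inj₂ (proj₂ (H.ends e))
  ends (inj₂ (inj₂ (u , v))) = inj₁ u , inj₂ v

  loopless : ∀ e → proj₁ (ends e) ≢ proj₂ (ends e)
  loopless (inj₁ e)        = G.loopless e ∘ inj₁-injective
  loopless (inj₂ (inj₁ e)) = H.loopless e ∘ inj₂-injective
  loopless (inj₂ (inj₂ _)) = λ ()

  pair₁ : ∀ {A B : Set} {a b c d : A} →
          (inj₁ {B = B} a , inj₁ {B = B} b) ≡ (inj₁ c , inj₁ d) → (a , b) ≡ (c , d)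
  pair₁ refl = refl

  pair₂ : ∀ {A B : Set} {a b c d : B} →
          (inj₂ {A = A} a , inj₂ {A = A} b) ≡ (inj₂ c , inj₂ d) → (a , b) ≡ (c , d)
  pair₂ refl = refl

  simple : ∀ d e → ends d ≡ ends e ⊎ ends d ≡ swap (ends e) → d ≡ e
  simple (inj₁ d) (inj₁ e) (inj₁ eq) = cong inj₁ (G.simple d e (inj₁ (pair₁ eq)))
  simple (inj₁ d) (inj₁ e) (inj₂ eq) = cong inj₁ (G.simple d e (inj₂ (pair₁ eq)))
  simple (inj₁ _) (inj₂ (inj₁ _)) (inj₁ ())
  simple (inj₁ _) (inj₂ (inj₁ _)) (inj₂ ())
  simple (inj₁ _) (inj₂ (inj₂ _)) (inj₁ ())
  simple (inj₁ _) (inj₂ (inj₂ _)) (inj₂ ())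
  simple (inj₂ (inj₁ _)) (inj₁ _) (inj₁ ())
  simple (inj₂ (inj₁ _)) (inj₁ _) (inj₂ ())
  simple (inj₂ (inj₁ d)) (inj₂ (inj₁ e)) (inj₁ eq) =
    cong (inj₂ ∘ inj₁) (H.simple d e (inj₁ (pair₂ eq)))
  simple (inj₂ (inj₁ d)) (inj₂ (inj₁ e)) (inj₂ eq) =
    cong (inj₂ ∘ inj₁) (H.simple d e (inj₂ (pair₂ eq)))
  simple (inj₂ (inj₁ _)) (inj₂ (inj₂ _)) (inj₁ ())
  simple (inj₂ (inj₁ _)) (inj₂ (inj₂ _)) (inj₂ ())
  simple (inj₂ (inj₂ _)) (inj₁ _) (inj₁ ())
  simple (inj₂ (inj₂ _)) (inj₁ _) (inj₂ ())
  simple (inj₂ (inj₂ _)) (inj₂ (inj₁ _)) (inj₁ ())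
  simple (inj₂ (inj₂ _)) (inj₂ (inj₁ _)) (inj₂ ())
  simple (inj₂ (inj₂ _)) (inj₂ (inj₂ _)) (inj₁ refl) = refl
  simple (inj₂ (inj₂ _)) (inj₂ (inj₂ _)) (inj₂ ())

FB : ℕ → Graph
FB n = (n · P 3) ∨ O 1

{-# OPTIONS --safe #-}

-- Upper bound: let n = 2k + 1.  The path edges of blade i get the labels i + 1
-- and n + π i + 1, where π is a permutation of {0, …, n - 1} for which
-- i + π i runs through the n consecutive values k, …, 3k; write
-- i + π i = k + σ i.  The spoke to an end of a blade gets the complement to
-- 4n + 1 of the path edge at that end, so that every end has sum 4n + 1, and
-- these labels exhaust 1, …, 4n.  The spokes to the middle vertices get the
-- labels 5n - σ i, so that every middle vertex has sum 6n + k + 2.  The hub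
-- sum is larger than both.  Lower bound: the graph contains a triangle.
module Submission where

open import Defs
open import Data.Empty using (⊥-elim)
open import Data.Fin using (Fin; zero; suc; toℕ; opposite; join; combine)
open import Data.Fin.Patterns using (0F; 1F; 2F; 3F; 4F)
open import Data.Fin.Permutation using (Permutation′; reverse; cast-id; _⟨$⟩ʳ_; _⟨$⟩ˡ_; inverseˡ; inverseʳ)
open import Data.Fin.Properties
  using (+↔⊎; *↔×; toℕ<n; toℕ-cast; toℕ-combine; toℕ-↑ˡ; toℕ-↑ʳ; opposite-prop)
open import Data.List using (List; []; _∷_; _++_; length; map)
open import Data.List.Membership.Propositional using (_∈_)
open import Data.List.Membership.Propositional.Properties
  using (∈-∃++; ∈-map⁺; ∈-map⁻; ∈-tabulate⁺; ∈-filter⁺; ∈-filter⁻; ∈-deduplicate⁺; ∈-deduplicate⁻)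
open import Data.List.Properties using (map-++; length-++)
open import Data.List.Relation.Binary.Permutation.Propositional using (_↭_; prep; ↭-refl; ↭-trans)
open import Data.List.Relation.Binary.Permutation.Propositional.Properties
  using (shift; ↭-length; ∈-resp-↭; map⁺)
open import Data.List.Relation.Binary.Subset.Propositional using (_⊆_)
open import Data.List.Relation.Unary.All using (lookup; []; _∷_)
open import Data.List.Relation.Unary.AllPairs using ([]; _∷_)
open import Data.List.Relation.Unary.Any using (here; there)
open import Data.List.Relation.Unary.Unique.DecPropositional.Properties using (deduplicate-!)
open import Data.List.Relation.Unary.Unique.Propositional using (Unique)
open import Data.List.Relation.Unary.Unique.Propositional.Properties using (filter⁺; tabulate⁺)
open import Data.Nat using (ℕ; zero; suc; _+_; _*_; _≤_; _<_; _≥_; _≟_; _/_; _%_; z≤n; s≤s)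
open import Data.Nat.DivMod using (m≡m%n+[m/n]*n)
open import Data.Nat.ListAction using (sum)
open import Data.Nat.ListAction.Properties using (sum-↭; sum-++)
open import Data.Nat.Properties
open import Data.Nat.Tactic.RingSolver using (solve-∀)
open import Data.Product using (_×_; _,_; proj₁; proj₂; ∃-syntax)
open import Data.Sum using (_⊎_; inj₁; inj₂)
import Data.Sum as Sum
open import Data.Sum.Function.Propositional using (_⊎-↔_)
open import Function using (_↔_; mk↔ₛ′; Inverse)
open import Function.Construct.Composition using (_↔-∘_)
open import Function.Construct.Identity using (↔-id)
open import Function.Construct.Symmetry using (↔-sym)
open import Function.Properties.Inverse using (↔⇒⤖)
open import Relation.Binary.PropositionalEquality
  using (_≡_; refl; sym; trans; cong; cong₂; subst; module ≡-Reasoning)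

-- Sums and lengths of duplicate-free lists.

private
  variable
    A : Set
    xs ys : List A

-- Induction on `xs`: an occurrence of the head `x` in `ys` is moved to the front and removed. Since
-- `x` is absent from the tail, the tail still lies in what remains of `ys`.
Unique-⊆⇒↭ : Unique xs → xs ⊆ ys → ∃[ zs ] ys ↭ xs ++ zs
Unique-⊆⇒↭ {xs = []} [] _ = _ , ↭-refl
Unique-⊆⇒↭ {xs = x ∷ xs} (x∉xs ∷ xs!) sub with ∈-∃++ (sub (here refl))
... | ps , qs , refl = proj₁ rec , ↭-trans (shift x ps qs) (prep x (proj₂ rec))
  where
  sub′ : xs ⊆ ps ++ qs
  sub′ z∈xs with ∈-resp-↭ (shift x ps qs) (sub (there z∈xs))
  ... | here z≡x = ⊥-elim (lookup x∉xs z∈xs (sym z≡x))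
  ... | there z∈ = z∈
  rec = Unique-⊆⇒↭ xs! sub′

Unique-⊆⇒sum-map-≤ : (g : A → ℕ) → Unique xs → xs ⊆ ys → sum (map g xs) ≤ sum (map g ys)
Unique-⊆⇒sum-map-≤ {xs = xs} {ys} g xs! sub with Unique-⊆⇒↭ xs! sub
... | zs , ys↭ = begin
  sum (map g xs)                   ≤⟨ m≤m+n _ _ ⟩
  sum (map g xs) + sum (map g zs)  ≡⟨ sum-++ (map g xs) (map g zs) ⟨
  sum (map g xs ++ map g zs)       ≡⟨ cong sum (map-++ g xs zs) ⟨
  sum (map g (xs ++ zs))           ≡⟨ sum-↭ (map⁺ g ys↭) ⟨
  sum (map g ys)                   ∎
  where open ≤-Reasoning

Unique-⊆⇒length-≤ : Unique xs → xs ⊆ ys → length xs ≤ length ys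
Unique-⊆⇒length-≤ {xs = xs} {ys} xs! sub with Unique-⊆⇒↭ xs! sub
... | zs , ys↭ = begin
  length xs                ≤⟨ m≤m+n _ _ ⟩
  length xs + length zs    ≡⟨ length-++ xs ⟨
  length (xs ++ zs)        ≡⟨ ↭-length ys↭ ⟨
  length ys                ∎
  where open ≤-Reasoning

-- Vertex sums and color numbers of an arbitrary graph.

module _ (G : Graph) (f : Labeling G) where
  open Graph G

  ∈-edges : ∀ e → e ∈ edges
  ∈-edges e = subst (_∈ edges) (Inverse.strictlyInverseʳ E↔Fin e) (∈-tabulate⁺ _)

  ∈-vertices : ∀ u → u ∈ vertices
  ∈-vertices u = subst (_∈ vertices) (Inverse.strictlyInverseʳ V↔Fin u) (∈-tabulate⁺ _)

  edges-! : Unique edges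
  edges-! = tabulate⁺ λ {i} {j} eq →
    trans (sym (Inverse.strictlyInverseˡ E↔Fin i))
      (trans (cong (Inverse.to E↔Fin) eq) (Inverse.strictlyInverseˡ E↔Fin j))

  -- Labels are nonnegative, so a partial list of incident edges bounds the sum from below. This
  -- serves the hub, whose degree grows with the graph.
  vertexSum-≥ : ∀ {u es} → Unique es → (∀ {e} → e ∈ es → Incident u e) →
                sum (map (label G f) es) ≤ vertexSum G f u
  vertexSum-≥ {u} es! inc = Unique-⊆⇒sum-map-≤ (label G f) es!
    λ {e} e∈ → ∈-filter⁺ (incident? u) (∈-edges e) (inc e∈)

  -- `es` and the filtered edge list are duplicate-free with the same elements. Bounding each sum by
  -- the other avoids evaluating the filter.
  vertexSum-≡ : ∀ {u es} → Unique es → (∀ {e} → e ∈ es → Incident u e) →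
                (∀ e → Incident u e → e ∈ es) →
                vertexSum G f u ≡ sum (map (label G f) es)
  vertexSum-≡ {u} es! inc cov = ≤-antisym
    (Unique-⊆⇒sum-map-≤ (label G f) (filter⁺ (incident? u) edges-!)
      λ {e} e∈ → cov e (proj₂ (∈-filter⁻ (incident? u) {xs = edges} e∈)))
    (vertexSum-≥ es! inc)

  private
    sums : List ℕ
    sums = map (vertexSum G f) vertices

  colorNumber-≤ : ∀ {cs} → (∀ u → vertexSum G f u ∈ cs) → colorNumber G f ≤ length cs
  colorNumber-≤ {cs} all∈ = Unique-⊆⇒length-≤ (deduplicate-! _≟_ sums) sub
    where
    sub : ∀ {c} → c ∈ _ → c ∈ cs
    sub c∈ with ∈-map⁻ (vertexSum G f) (∈-deduplicate⁻ _≟_ sums c∈)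
    ... | u , _ , refl = all∈ u

  colorNumber-≥ : ∀ {us} → Unique (map (vertexSum G f) us) → length (map (vertexSum G f) us) ≤ colorNumber G f
  colorNumber-≥ {us} us! = Unique-⊆⇒length-≤ us! sub
    where
    sub : ∀ {c} → c ∈ map (vertexSum G f) us → c ∈ _
    sub c∈ with ∈-map⁻ (vertexSum G f) c∈
    ... | u , _ , refl = ∈-deduplicate⁺ _≟_ (∈-map⁺ (vertexSum G f) (∈-vertices u))

-- Lower bound.

FB-colorNumber-≥ : ∀ n f → n ≥ 1 → LocalAntimagic (FB n) f → 3 ≤ colorNumber (FB n) f
FB-colorNumber-≥ (suc n) f _ la =
  -- These vertices of the first blade form a triangle with the hub; the antimagic condition on its
  -- three edges is exactly pairwise distinctness of the three sums.
  colorNumber-≥ (FB (suc n)) f {inj₁ (zero , 0F) ∷ inj₁ (zero , 1F) ∷ inj₂ zero ∷ []}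
    ((la (inj₁ (zero , 0F)) ∷ la (inj₂ (inj₂ ((zero , 0F) , zero))) ∷ [])
    ∷ (la (inj₂ (inj₂ ((zero , 1F) , zero))) ∷ [])
    ∷ [] ∷ [])

-- Reflection inside a block of labels.

1+toℕ+opposite : ∀ {n} (i : Fin n) → suc (toℕ i) + toℕ (opposite i) ≡ n
1+toℕ+opposite i = trans (cong (suc (toℕ i) +_) (opposite-prop i)) (m+[n∸m]≡n (toℕ<n i))

-- The offsets `i` and `opposite i` add up to n - 1, so the total depends only on the two blocks.
-- The trailing `+ 0` is the one left by `sum` on a two-element list.
complementary-labels : ∀ {n} a b (i : Fin n) →
  suc (n * a + toℕ i) + (suc (n * b + toℕ (opposite i)) + 0) ≡ suc (n * suc (a + b))
complementary-labels {n} a b i = begin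
  suc (n * a + toℕ i) + (suc (n * b + toℕ (opposite i)) + 0)
    ≡⟨ rearrange n a b (toℕ i) (toℕ (opposite i)) ⟩
  suc (suc (toℕ i) + toℕ (opposite i) + n * (a + b))
    ≡⟨ cong (λ s → suc (s + n * (a + b))) (1+toℕ+opposite i) ⟩
  suc (n + n * (a + b))
    ≡⟨ cong suc (*-suc n (a + b)) ⟨
  suc (n * suc (a + b)) ∎
  where
  open ≡-Reasoning
  rearrange : ∀ n a b i o → suc (n * a + i) + (suc (n * b + o) + 0) ≡ suc (suc i + o + n * (a + b))
  rearrange = solve-∀

-- The permutations π and σ.

-- The left summand fills the even positions and the right one the odd positions. Writing `k * 2`
-- rather than `2 * k` lets the size reduce to two successors at each recursive call.
interleave : ∀ {k} → Fin (suc k) ⊎ Fin k → Fin (suc (k * 2))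
interleave         (inj₁ zero)    = zero
interleave {suc k} (inj₁ (suc j)) = suc (suc (interleave (inj₁ j)))
interleave {suc k} (inj₂ zero)    = suc zero
interleave {suc k} (inj₂ (suc j)) = suc (suc (interleave (inj₂ j)))

uninterleave : ∀ {k} → Fin (suc (k * 2)) → Fin (suc k) ⊎ Fin k
uninterleave         zero          = inj₁ zero
uninterleave {suc k} (suc zero)    = inj₂ zero
uninterleave {suc k} (suc (suc i)) = Sum.map suc suc (uninterleave i)

interleave-suc : ∀ {k} (s : Fin (suc k) ⊎ Fin k) → interleave (Sum.map suc suc s) ≡ suc (suc (interleave s))
interleave-suc (inj₁ _) = refl
interleave-suc (inj₂ _) = refl

interleave-uninterleave : ∀ {k} i → interleave {k} (uninterleave i) ≡ i
interleave-uninterleave         zero          = refl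
interleave-uninterleave {suc k} (suc zero)    = refl
interleave-uninterleave {suc k} (suc (suc i)) =
  trans (interleave-suc (uninterleave {k} i)) (cong (λ m → suc (suc m)) (interleave-uninterleave {k} i))

uninterleave-interleave : ∀ {k} s → uninterleave {k} (interleave s) ≡ s
uninterleave-interleave         (inj₁ zero)    = refl
uninterleave-interleave {suc k} (inj₁ (suc j)) = cong (Sum.map suc suc) (uninterleave-interleave (inj₁ j))
uninterleave-interleave {suc k} (inj₂ zero)    = refl
uninterleave-interleave {suc k} (inj₂ (suc j)) = cong (Sum.map suc suc) (uninterleave-interleave (inj₂ j))

interleave-↔ : ∀ k → (Fin (suc k) ⊎ Fin k) ↔ Fin (suc (k * 2))
interleave-↔ k = mk↔ₛ′ interleave uninterleave interleave-uninterleave uninterleave-interleave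

toℕ-interleave₁ : ∀ {k} (j : Fin (suc k)) → toℕ (interleave {k} (inj₁ j)) ≡ toℕ j * 2
toℕ-interleave₁         zero    = refl
toℕ-interleave₁ {suc k} (suc j) = cong (λ m → suc (suc m)) (toℕ-interleave₁ j)

toℕ-interleave₂ : ∀ {k} (j : Fin k) → toℕ (interleave {k} (inj₂ j)) ≡ suc (toℕ j * 2)
toℕ-interleave₂ {suc k} zero    = refl
toℕ-interleave₂ {suc k} (suc j) = cong (λ m → suc (suc m)) (toℕ-interleave₂ j)

1+k+k≡1+k*2 : ∀ k → suc k + k ≡ suc (k * 2)
1+k+k≡1+k*2 = solve-∀

-- The left summand goes to 0, ..., k and the right one to k + 1, ..., 2k.
concat-↔ : ∀ k → (Fin (suc k) ⊎ Fin k) ↔ Fin (suc (k * 2))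
concat-↔ k = cast-id (1+k+k≡1+k*2 k) ↔-∘ ↔-sym +↔⊎

toℕ-concat₁ : ∀ {k} (j : Fin (suc k)) → toℕ (Inverse.to (concat-↔ k) (inj₁ j)) ≡ toℕ j
toℕ-concat₁ {k} j = trans (toℕ-cast (1+k+k≡1+k*2 k) (join (suc k) k (inj₁ j))) (toℕ-↑ˡ j k)

toℕ-concat₂ : ∀ {k} (j : Fin k) → toℕ (Inverse.to (concat-↔ k) (inj₂ j)) ≡ suc k + toℕ j
toℕ-concat₂ {k} j = trans (toℕ-cast (1+k+k≡1+k*2 k) (join (suc k) k (inj₂ j))) (toℕ-↑ʳ (suc k) j)

-- π (2j) = k - j and π (2j + 1) = 2k - j.
π : ∀ k → Permutation′ (suc (k * 2))
π k = concat-↔ k ↔-∘ ((reverse ⊎-↔ reverse) ↔-∘ ↔-sym (interleave-↔ k))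

-- σ (2j) = j and σ (2j + 1) = k + 1 + j.
σ : ∀ k → Permutation′ (suc (k * 2))
σ k = concat-↔ k ↔-∘ ↔-sym (interleave-↔ k)

-- At even positions 2j + (k - j) = k + j; at odd positions (2j + 1) + (2k - j) = k + (k + 1 + j).
interleave+concat : ∀ {k} (s : Fin (suc k) ⊎ Fin k) →
  toℕ (interleave s) + toℕ (Inverse.to (concat-↔ k) (Sum.map opposite opposite s))
    ≡ k + toℕ (Inverse.to (concat-↔ k) s)
interleave+concat {k} (inj₁ j) = begin
  toℕ (interleave {k} (inj₁ j)) + toℕ (Inverse.to (concat-↔ k) (inj₁ (opposite j)))
    ≡⟨ cong₂ _+_ (toℕ-interleave₁ j) (toℕ-concat₁ (opposite j)) ⟩
  toℕ j * 2 + toℕ (opposite j)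
    ≡⟨ rearrange (toℕ j) (toℕ (opposite j)) ⟩
  (toℕ j + toℕ (opposite j)) + toℕ j
    -- Here `j` lives in `Fin (suc k)`, so `j` and its opposite add up to k; in the odd case they
    -- add up to k - 1.
    ≡⟨ cong₂ _+_ (suc-injective (1+toℕ+opposite j)) (sym (toℕ-concat₁ j)) ⟩
  k + toℕ (Inverse.to (concat-↔ k) (inj₁ j)) ∎
  where
  open ≡-Reasoning
  rearrange : ∀ a b → a * 2 + b ≡ (a + b) + a
  rearrange = solve-∀
interleave+concat {k} (inj₂ j) = begin
  toℕ (interleave {k} (inj₂ j)) + toℕ (Inverse.to (concat-↔ k) (inj₂ (opposite j)))
    ≡⟨ cong₂ _+_ (toℕ-interleave₂ j) (toℕ-concat₂ (opposite j)) ⟩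
  suc (toℕ j * 2) + (suc k + toℕ (opposite j))
    ≡⟨ rearrange (toℕ j) k (toℕ (opposite j)) ⟩
  (suc (toℕ j) + toℕ (opposite j)) + (suc k + toℕ j)
    ≡⟨ cong₂ _+_ (1+toℕ+opposite j) (sym (toℕ-concat₂ j)) ⟩
  k + toℕ (Inverse.to (concat-↔ k) (inj₂ j)) ∎
  where
  open ≡-Reasoning
  rearrange : ∀ a k b → suc (a * 2) + (suc k + b) ≡ (suc a + b) + (suc k + a)
  rearrange = solve-∀

i+πi≡k+σi : ∀ k i → toℕ i + toℕ (π k ⟨$⟩ʳ i) ≡ k + toℕ (σ k ⟨$⟩ʳ i)
i+πi≡k+σi k i = trans
  -- Only the first summand is rewritten: `π` and `σ` already unfold to functions of
  -- `uninterleave i`.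
  (cong (λ j → toℕ j + toℕ (π k ⟨$⟩ʳ i)) (sym (interleave-uninterleave {k} i)))
  (interleave+concat (uninterleave {k} i))

-- The labeling of the fan graph.

-- Row t will receive the block of labels tn + 1, ..., tn + n. The order of the rows makes the path
-- edge and the spoke at each blade end lie in rows 0 and 3, or 1 and 2, with row sum 3 in both
-- cases.
FB-edges-↔ : ∀ n → Graph.E (FB n) ↔ (Fin 5 × Fin n)
FB-edges-↔ n = mk↔ₛ′ to from to-from from-to
  where
  to : Graph.E (FB n) → Fin 5 × Fin n
  to (inj₁ (i , 0F))                 = 0F , i
  to (inj₁ (i , 1F))                 = 1F , i
  to (inj₂ (inj₂ ((i , 2F) , zero))) = 2F , i
  to (inj₂ (inj₂ ((i , 0F) , zero))) = 3F , i
  to (inj₂ (inj₂ ((i , 1F) , zero))) = 4F , i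
  from : Fin 5 × Fin n → Graph.E (FB n)
  from (0F , i) = inj₁ (i , 0F)
  from (1F , i) = inj₁ (i , 1F)
  from (2F , i) = inj₂ (inj₂ ((i , 2F) , zero))
  from (3F , i) = inj₂ (inj₂ ((i , 0F) , zero))
  from (4F , i) = inj₂ (inj₂ ((i , 1F) , zero))
  to-from : ∀ c → to (from c) ≡ c
  to-from (0F , _) = refl
  to-from (1F , _) = refl
  to-from (2F , _) = refl
  to-from (3F , _) = refl
  to-from (4F , _) = refl
  from-to : ∀ e → from (to e) ≡ e
  from-to (inj₁ (_ , 0F))                 = refl
  from-to (inj₁ (_ , 1F))                 = refl
  from-to (inj₂ (inj₂ ((_ , 0F) , zero))) = refl
  from-to (inj₂ (inj₂ ((_ , 1F) , zero))) = refl
  from-to (inj₂ (inj₂ ((_ , 2F) , zero))) = refl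

permuteRows : ∀ {m n} → (Fin m → Permutation′ n) → (Fin m × Fin n) ↔ (Fin m × Fin n)
permuteRows ρ = mk↔ₛ′
  (λ (t , i) → t , ρ t ⟨$⟩ʳ i) (λ (t , i) → t , ρ t ⟨$⟩ˡ i)
  (λ (t , _) → cong (t ,_) (inverseʳ (ρ t))) (λ (t , _) → cong (t ,_) (inverseˡ (ρ t)))

module UpperBound (k : ℕ) where

  n : ℕ
  n = suc (k * 2)

  G : Graph
  G = FB n

  open Graph G using (V; E; Incident; size)

  -- Rows 3 and 2 reverse rows 0 and 1 to give complementary labels. Row 4 reverses `σ` so that the
  -- middle sum loses its dependence on the blade.
  row : Fin 5 → Permutation′ n
  row 0F = ↔-id _
  row 1F = π k
  row 2F = reverse ↔-∘ π k
  row 3F = reverse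
  row 4F = reverse ↔-∘ σ k

  5n≡size : 5 * n ≡ size
  5n≡size = identity n
    where
    identity : ∀ n → 5 * n ≡ n * 2 + (0 + (n * 3) * 1)
    identity = solve-∀

  f : Labeling G
  f = ↔⇒⤖ (cast-id 5n≡size ↔-∘ (↔-sym *↔× ↔-∘ (permuteRows row ↔-∘ FB-edges-↔ n)))

  label-f : ∀ e → let t , i = Inverse.to (FB-edges-↔ n) e in
            label G f e ≡ suc (n * toℕ t + toℕ (row t ⟨$⟩ʳ i))
  label-f e = let t , i = Inverse.to (FB-edges-↔ n) e in
    cong suc (trans (toℕ-cast 5n≡size (combine t (row t ⟨$⟩ʳ i))) (toℕ-combine t (row t ⟨$⟩ʳ i)))

  -- A bound by the block alone, whatever the position inside it; this is precise enough for the
  -- hub.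
  label-> : ∀ e → n * toℕ (proj₁ (Inverse.to (FB-edges-↔ n) e)) < label G f e
  label-> e = let t , i = Inverse.to (FB-edges-↔ n) e in
    subst (n * toℕ t <_) (sym (label-f e)) (s≤s (m≤m+n (n * toℕ t) (toℕ (row t ⟨$⟩ʳ i))))

  pathEdge₁ pathEdge₂ spoke₁ spoke₂ spoke₃ : Fin n → E
  pathEdge₁ i = inj₁ (i , 0F)
  pathEdge₂ i = inj₁ (i , 1F)
  spoke₁ i = inj₂ (inj₂ ((i , 0F) , zero))
  spoke₂ i = inj₂ (inj₂ ((i , 1F) , zero))
  spoke₃ i = inj₂ (inj₂ ((i , 2F) , zero))

  hub : V
  hub = inj₂ zero

  -- `hubSum` stays unevaluated: only its being larger than the other two matters.
  endSum middleSum hubSum : ℕ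
  endSum    = suc (n * 4)
  middleSum = 2 + n * 6 + k
  hubSum    = vertexSum G f hub

  end₁-sum : ∀ i → vertexSum G f (inj₁ (i , 0F)) ≡ endSum
  end₁-sum i = begin
    vertexSum G f (inj₁ (i , 0F))
      ≡⟨ vertexSum-≡ G f (((λ ()) ∷ []) ∷ [] ∷ []) inc cov ⟩
    label G f (pathEdge₁ i) + (label G f (spoke₁ i) + 0)
      ≡⟨ cong₂ (λ a c → a + (c + 0)) (label-f (pathEdge₁ i)) (label-f (spoke₁ i)) ⟩
    suc (n * 0 + toℕ i) + (suc (n * 3 + toℕ (opposite i)) + 0)
      ≡⟨ complementary-labels 0 3 i ⟩
    endSum ∎
    where
    open ≡-Reasoning
    inc : ∀ {e} → e ∈ pathEdge₁ i ∷ spoke₁ i ∷ [] → Incident (inj₁ (i , 0F)) e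
    inc (here refl)         = inj₁ refl
    inc (there (here refl)) = inj₁ refl
    cov : ∀ e → Incident (inj₁ (i , 0F)) e → e ∈ pathEdge₁ i ∷ spoke₁ i ∷ []
    cov (inj₁ (_ , 0F))          (inj₁ refl) = here refl
    cov (inj₁ (_ , 0F))          (inj₂ ())
    cov (inj₁ (_ , 1F))          (inj₁ ())
    cov (inj₁ (_ , 1F))          (inj₂ ())
    cov (inj₂ (inj₂ (_ , zero))) (inj₁ refl) = there (here refl)

  end₂-sum : ∀ i → vertexSum G f (inj₁ (i , 2F)) ≡ endSum
  end₂-sum i = begin
    vertexSum G f (inj₁ (i , 2F))
      ≡⟨ vertexSum-≡ G f (((λ ()) ∷ []) ∷ [] ∷ []) inc cov ⟩
    label G f (pathEdge₂ i) + (label G f (spoke₃ i) + 0)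
      ≡⟨ cong₂ (λ a c → a + (c + 0)) (label-f (pathEdge₂ i)) (label-f (spoke₃ i)) ⟩
    suc (n * 1 + toℕ p) + (suc (n * 2 + toℕ (opposite p)) + 0)
      ≡⟨ complementary-labels 1 2 p ⟩
    endSum ∎
    where
    open ≡-Reasoning
    p = π k ⟨$⟩ʳ i
    inc : ∀ {e} → e ∈ pathEdge₂ i ∷ spoke₃ i ∷ [] → Incident (inj₁ (i , 2F)) e
    inc (here refl)         = inj₂ refl
    inc (there (here refl)) = inj₁ refl
    cov : ∀ e → Incident (inj₁ (i , 2F)) e → e ∈ pathEdge₂ i ∷ spoke₃ i ∷ []
    cov (inj₁ (_ , 0F))          (inj₁ ())
    cov (inj₁ (_ , 0F))          (inj₂ ())
    cov (inj₁ (_ , 1F))          (inj₁ ())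
    cov (inj₁ (_ , 1F))          (inj₂ refl) = here refl
    cov (inj₂ (inj₂ (_ , zero))) (inj₁ refl) = there (here refl)

  middle-sum : ∀ i → vertexSum G f (inj₁ (i , 1F)) ≡ middleSum
  middle-sum i = begin
    vertexSum G f (inj₁ (i , 1F))
      ≡⟨ vertexSum-≡ G f (((λ ()) ∷ (λ ()) ∷ []) ∷ ((λ ()) ∷ []) ∷ [] ∷ []) inc cov ⟩
    label G f (pathEdge₁ i) + (label G f (pathEdge₂ i) + (label G f (spoke₂ i) + 0))
      ≡⟨ cong₂ _+_ (label-f (pathEdge₁ i))
           (cong₂ (λ b d → b + (d + 0)) (label-f (pathEdge₂ i)) (label-f (spoke₂ i))) ⟩
    suc (n * 0 + toℕ i) + (suc (n * 1 + toℕ p) + (suc (n * 4 + toℕ (opposite s)) + 0))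
      ≡⟨ rearrange n (toℕ i) (toℕ p) (toℕ (opposite s)) ⟩
    3 + n * 5 + (toℕ i + toℕ p) + toℕ (opposite s)
      -- The two path labels now depend on the blade only through `σ`, and the reversed `σ` in the
      -- spoke label cancels this below.
      ≡⟨ cong (λ a → 3 + n * 5 + a + toℕ (opposite s)) (i+πi≡k+σi k i) ⟩
    3 + n * 5 + (k + toℕ s) + toℕ (opposite s)
      ≡⟨ regroup n k (toℕ s) (toℕ (opposite s)) ⟩
    2 + n * 5 + k + (suc (toℕ s) + toℕ (opposite s))
      ≡⟨ cong (2 + n * 5 + k +_) (1+toℕ+opposite s) ⟩
    2 + n * 5 + k + n
      ≡⟨ collect n k ⟩
    middleSum ∎
    where
    open ≡-Reasoning
    p = π k ⟨$⟩ʳ i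
    s = σ k ⟨$⟩ʳ i
    inc : ∀ {e} → e ∈ pathEdge₁ i ∷ pathEdge₂ i ∷ spoke₂ i ∷ [] → Incident (inj₁ (i , 1F)) e
    inc (here refl)                 = inj₂ refl
    inc (there (here refl))         = inj₁ refl
    inc (there (there (here refl))) = inj₁ refl
    cov : ∀ e → Incident (inj₁ (i , 1F)) e → e ∈ pathEdge₁ i ∷ pathEdge₂ i ∷ spoke₂ i ∷ []
    cov (inj₁ (_ , 0F))          (inj₁ ())
    cov (inj₁ (_ , 0F))          (inj₂ refl) = here refl
    cov (inj₁ (_ , 1F))          (inj₁ refl) = there (here refl)
    cov (inj₁ (_ , 1F))          (inj₂ ())
    cov (inj₂ (inj₂ (_ , zero))) (inj₁ refl) = there (there (here refl))
    rearrange : ∀ n a p o → suc (n * 0 + a) + (suc (n * 1 + p) + (suc (n * 4 + o) + 0))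
                ≡ 3 + n * 5 + (a + p) + o
    rearrange = solve-∀
    regroup : ∀ n k s o → 3 + n * 5 + (k + s) + o ≡ 2 + n * 5 + k + (suc s + o)
    regroup = solve-∀
    collect : ∀ n k → 2 + n * 5 + k + n ≡ 2 + n * 6 + k
    collect = solve-∀

  endSum<middleSum : endSum < middleSum
  endSum<middleSum = s≤s (s≤s (≤-trans (*-monoʳ-≤ n (m≤m+n 4 2)) (m≤m+n (n * 6) k)))

  -- The three spokes of a single blade already outweigh a middle vertex.
  middleSum<hubSum : middleSum < hubSum
  middleSum<hubSum = begin-strict
    2 + n * 6 + k
      <⟨ m<m+n _ (s≤s (z≤n {1 + (n * 2 + k)})) ⟩
    -- The added 2n + k + 2 is the gap between `middleSum` and 9n + 3, computed with n = 2k + 1.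
    2 + n * 6 + k + (2 + (n * 2 + k))
      ≡⟨ collect k ⟩
    suc (n * 3) + (suc (n * 4) + (suc (n * 2) + 0))
      ≤⟨ +-mono-≤ (label-> (spoke₁ zero)) (+-mono-≤ (label-> (spoke₂ zero)) (+-monoˡ-≤ 0 (label-> (spoke₃ zero)))) ⟩
    label G f (spoke₁ zero) + (label G f (spoke₂ zero) + (label G f (spoke₃ zero) + 0))
      ≤⟨ vertexSum-≥ G f {hub} (((λ ()) ∷ (λ ()) ∷ []) ∷ ((λ ()) ∷ []) ∷ [] ∷ []) inc ⟩
    hubSum ∎
    where
    open ≤-Reasoning
    inc : ∀ {e} → e ∈ spoke₁ zero ∷ spoke₂ zero ∷ spoke₃ zero ∷ [] → Incident hub e
    inc (here refl)                 = inj₂ refl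
    inc (there (here refl))         = inj₂ refl
    inc (there (there (here refl))) = inj₂ refl
    collect : ∀ k → 2 + suc (k * 2) * 6 + k + (2 + (suc (k * 2) * 2 + k))
              ≡ suc (suc (k * 2) * 3) + (suc (suc (k * 2) * 4) + (suc (suc (k * 2) * 2) + 0))
    collect = solve-∀

  f-localAntimagic : LocalAntimagic G f
  f-localAntimagic (inj₁ (i , 0F)) eq =
    <⇒≢ endSum<middleSum (trans (sym (end₁-sum i)) (trans eq (middle-sum i)))
  f-localAntimagic (inj₁ (i , 1F)) eq =
    <⇒≢ endSum<middleSum (trans (sym (end₂-sum i)) (trans (sym eq) (middle-sum i)))
  f-localAntimagic (inj₂ (inj₂ ((i , 0F) , zero))) eq =
    <⇒≢ (<-trans endSum<middleSum middleSum<hubSum) (trans (sym (end₁-sum i)) eq)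
  f-localAntimagic (inj₂ (inj₂ ((i , 1F) , zero))) eq =
    <⇒≢ middleSum<hubSum (trans (sym (middle-sum i)) eq)
  f-localAntimagic (inj₂ (inj₂ ((i , 2F) , zero))) eq =
    <⇒≢ (<-trans endSum<middleSum middleSum<hubSum) (trans (sym (end₂-sum i)) eq)

  f-colorNumber-≤ : colorNumber G f ≤ 3
  f-colorNumber-≤ = colorNumber-≤ G f {endSum ∷ middleSum ∷ hubSum ∷ []} λ where
    (inj₁ (i , 0F)) → here (end₁-sum i)
    (inj₁ (i , 1F)) → there (here (middle-sum i))
    (inj₁ (i , 2F)) → here (end₂-sum i)
    (inj₂ zero)     → there (there (here refl))

-- The exact value for odd n.

χla-FB-odd : ∀ k → χla[ FB (suc (k * 2)) ]≡ 3
χla-FB-odd k =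
  (f , f-localAntimagic , ≤-antisym f-colorNumber-≤ (lower f f-localAntimagic)) , lower
  where
  open UpperBound k
  lower : ∀ f → LocalAntimagic G f → 3 ≤ colorNumber G f
  lower f = FB-colorNumber-≥ n f (s≤s z≤n)

theorem2p1 : (n : ℕ) → n ≥ 1 → n % 2 ≡ 1 → χla[ FB n ]≡ 3
theorem2p1 n _ n-odd = subst (λ m → χla[ FB m ]≡ 3) (sym n≡1+k*2) (χla-FB-odd (n / 2))
  where
  n≡1+k*2 : n ≡ suc (n / 2 * 2)
  -- Division by 2 with the remainder replaced by 1.
  n≡1+k*2 = trans (m≡m%n+[m/n]*n n 2) (cong (_+ n / 2 * 2) n-odd)
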